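{- Let $p$ be a prime with $p\equiv 1\pmod 3$ and let $a$ be a positive integer. Then $$\sum_{k=1}^{\frac{2}{3}(p^a-1)}\binom{2k}{k}\equiv 0\pmod{p^2}.$$
   Context: Note that $\frac23(p^a-1)$ is a positive integer since $p^a\equiv1\pmod 3$. -}

module Defs where

open import Data.List.Base using (applyUpTo)
open import Data.Nat.Base using (ℕ; zero; suc; _+_; _*_; _∸_; _^_; _/_; _%_)
open import Data.Nat.Divisibility using (_∣_; divides; ∣n⇒∣m*n)
open import Data.Nat.DivMod using (m≡m%n+[m/n]*n; %-distribˡ-*; m*[n/m]≡n)
open import Data.Nat.ListAction using (sum)
open import Relation.Binary.PropositionalEquality
  using (_≡_; refl; trans; cong; cong₂)

-- f 1 + f 2 + ⋯ + f n
sumFrom1 : ℕ → (ℕ → ℕ) → ℕ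
sumFrom1 n f = sum (applyUpTo (λ i → f (suc i)) n)

syntax sumFrom1 n (λ k → t) = ∑[ k from1to n ] t

-- ⅔ (p ^ a − 1).  The division is exact when p ≡ 1 (mod 3); see
-- 3*upperBound.
upperBound : ℕ → ℕ → ℕ
upperBound p a = (2 * (p ^ a ∸ 1)) / 3

private
  p^a%3≡1 : ∀ p a → p % 3 ≡ 1 → (p ^ a) % 3 ≡ 1
  p^a%3≡1 p zero    h = refl
  p^a%3≡1 p (suc a) h = trans (%-distribˡ-* p (p ^ a) 3)
    (cong₂ (λ x y → (x * y) % 3) h (p^a%3≡1 p a h))

  3∣m∸1 : ∀ m → m % 3 ≡ 1 → 3 ∣ m ∸ 1
  3∣m∸1 m h = divides (m / 3)
    (cong (_∸ 1) (trans (m≡m%n+[m/n]*n m 3) (cong (_+ (m / 3) * 3) h)))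

3*upperBound : ∀ p a → p % 3 ≡ 1 → 3 * upperBound p a ≡ 2 * (p ^ a ∸ 1)
3*upperBound p a h = m*[n/m]≡n (∣n⇒∣m*n 2 (3∣m∸1 (p ^ a) (p^a%3≡1 p a h)))

{-# OPTIONS --safe #-}

-- Put q = pᵃ = 3m + 1 (m is even), N = 1 + x + x² and V = x(1 + x).  From
-- (1 + x)² = N + x, the sum of the C(2k,k) over 0 ≤ k ≤ 2m is the coefficient
-- of x²ᵐ in (1 + x)^(q+m+1) / N.  The quantities 1 + x, −1, −x have sum zero,
-- so Newton's recursion writes their q-th power sum as
--   (1 + x)^q − 1 − x^q = Σ c(i,j) Nⁱ Vʲ   (2i + 3j = q, hence i ≥ 1),
-- where (i + j) c(i,j) = q C(i+j,i).  The part 1 + x^q contributes the term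
-- k = 0.  Since 0 < i + j < q, p divides each c(i,j), and it remains to see that
-- p divides the coefficient of x²ᵐ in (1 + x)^(m+1) Nⁱ⁻¹ Vʲ.  This is U₀ + U₁,
-- U₀ and U₁ being the coefficients of x²ᵐ and x²ᵐ⁻¹ in (1 + x)ᵐ Nⁱ⁻¹ Vʲ.
-- They are equal because that polynomial is palindromic.  Moreover U₀ + 2U₁ is
-- the coefficient of x^(q−1) in (1 + 2x) Vᵐ⁺ʲ Nⁱ⁻¹, a combination of the
-- derivatives of Vˡ⁺¹/(l + 1) with l + 1 < q, so it is divisible by p.
-- Thus p ∣ 3U₀.
module Submission where

open import Defs
open import Data.Nat.Base using (ℕ; _*_; _^_; _%_; _≤_)
open import Data.Nat.Combinatorics using (_C_)
open import Data.Nat.Divisibility using (_∣_)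
open import Data.Nat.Primality using (Prime)
open import Relation.Binary.PropositionalEquality using (_≡_)

open import Data.Nat.Base as ℕ using (zero; suc; _+_; _∸_; _<_; s≤s)
import Data.Nat.Properties as ℕₚ
open import Data.Nat.Combinatorics using (nCk+nC[k+1]≡[n+1]C[k+1])
open import Data.Integer.Base as ℤ using (ℤ; +_; 0ℤ; 1ℤ)
  renaming (_+_ to _+ᶻ_; _*_ to _*ᶻ_; -_ to -ᶻ_)
open import Data.Integer.Divisibility.Signed
  using (divides; ∣m∣n⇒∣m+n; ∣n⇒∣m*n; ∣m⇒∣m*n; ∣⇒∣ᵤ; *-monoʳ-∣; *-cancelˡ-∣)
  renaming (_∣_ to _∣ᶻ_)
import Data.Integer.Properties as ℤₚ
import Data.Integer.Tactic.RingSolver as ℤ-Solver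
import Data.Nat.Tactic.RingSolver as ℕ-Solver
open import Data.List.Base using (applyUpTo; [_]; _++_)
open import Data.List.Properties using (applyUpTo-∷ʳ)
open import Data.Nat.ListAction using (sum)
open import Data.Nat.ListAction.Properties using (sum-++)
open import Data.Nat.Coprimality using (Coprime; coprime-Bézout)
open import Data.Nat.Divisibility as ℕ∣ using (_∣?_; ∣⇒≤)
open import Data.Nat.DivMod
  using (_/_; m*n%n≡0; m%n<n; m∣n⇒o%n%m≡o%m; [m+kn]%n≡m%n; m≡m%n+[m/n]*n;
    %-distribˡ-*)
open import Data.Nat.GCD using (module Bézout)
open import Data.Nat.Primality using (prime⇒irreducible; prime⇒nonZero)
open import Data.Product.Base using (∃₂; _,_; proj₁; proj₂)
open import Data.Sum.Base using (inj₁; inj₂)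
open import Relation.Binary.Definitions using (Tri; tri<; tri≈; tri>)
open import Relation.Nullary using (¬_; yes; no; contradiction)
open import Relation.Binary.PropositionalEquality
  using (refl; sym; trans; cong; cong₂; subst; module ≡-Reasoning)

-- Coefficients of products of powers of x, 1 + x and N

sgn : ℕ → ℤ
sgn zero    = 1ℤ
sgn (suc n) = -ᶻ sgn n

-- The nontrivial Dirichlet character modulo 3, since 1/N = (1 - x)/(1 - x³) has coefficients 1, -1,
-- 0 repeating. The period starts at 0, so that the truncated subtraction in `W` gives 0 once k
-- exceeds D.
χ : ℕ → ℤ
χ 0 = 0ℤ
χ 1 = 1ℤ
χ 2 = ℤ.-1ℤ
χ (suc (suc (suc n))) = χ n

-- N times its inverse series has no term of degree n + 1.
χ-sum : ∀ n → χ (2 + n) +ᶻ (χ (1 + n) +ᶻ χ n) ≡ 0ℤ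
χ-sum 0 = refl
χ-sum 1 = refl
χ-sum 2 = refl
χ-sum (suc (suc (suc n))) = χ-sum n

-- W D a i k is the coefficient of x^D in xᵏ (1 + x)ᵃ Nⁱ⁻¹, where 1/N is the
-- power series Σ χ(n+1) xⁿ; note the shift in i.  Identities between polynomials
-- in x, 1 + x and N become linear relations between shifts of the indices.
W : ℕ → ℕ → ℕ → ℕ → ℤ
W D zero    zero    k = χ (suc D ∸ k)
W D zero    (suc i) k = W D 0 i k +ᶻ (W D 0 i (1 + k) +ᶻ W D 0 i (2 + k))
W D (suc a) i       k = W D a i k +ᶻ W D a i (suc k)

module _ (D : ℕ) where

  -- N = 1 + x(1 + x).
  W-trinomial : ∀ a i k →
    W D a (suc i) k ≡ W D a i k +ᶻ W D (suc a) i (suc k)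
  W-trinomial zero    i k = refl
  W-trinomial (suc a) i k = begin
    W D a (suc i) k +ᶻ W D a (suc i) (suc k)
      ≡⟨ cong₂ _+ᶻ_ (W-trinomial a i k) (W-trinomial a i (suc k)) ⟩
    (w₀ +ᶻ (w₁ +ᶻ w₂)) +ᶻ (w₁ +ᶻ (w₂ +ᶻ w₃))
      ≡⟨ rearrange w₀ w₁ w₂ w₃ ⟩
    (w₀ +ᶻ w₁) +ᶻ ((w₁ +ᶻ w₂) +ᶻ (w₂ +ᶻ w₃)) ∎
    where
    open ≡-Reasoning
    w₀ = W D a i k
    w₁ = W D a i (1 + k)
    w₂ = W D a i (2 + k)
    w₃ = W D a i (3 + k)
    rearrange : ∀ x y z t → (x +ᶻ (y +ᶻ z)) +ᶻ (y +ᶻ (z +ᶻ t)) ≡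
      (x +ᶻ y) +ᶻ ((y +ᶻ z) +ᶻ (z +ᶻ t))
    rearrange = ℤ-Solver.solve-∀

  W-vanish : ∀ a i k → D < k → W D a i k ≡ 0ℤ
  W-vanish zero    zero    k D<k = cong χ (ℕₚ.m≤n⇒m∸n≡0 D<k)
  W-vanish zero    (suc i) k D<k = cong₂ _+ᶻ_ (W-vanish 0 i k D<k)
    (cong₂ _+ᶻ_ (W-vanish 0 i (1 + k) (ℕₚ.m<n⇒m<1+n D<k))
                (W-vanish 0 i (2 + k) (ℕₚ.m<n⇒m<1+n (ℕₚ.m<n⇒m<1+n D<k))))
  W-vanish (suc a) i       k D<k = cong₂ _+ᶻ_ (W-vanish a i k D<k)
    (W-vanish a i (suc k) (ℕₚ.m<n⇒m<1+n D<k))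

  private
    χ-at : ∀ {k} r → k + r ≡ suc D → W D 0 0 k ≡ χ r
    χ-at {k} r eq = cong χ (trans (cong (_∸ k) (sym eq)) (ℕₚ.m+n∸m≡n k r))

  -- At i = 1 the exponent of N is 0, so only xᵏ (1 + x)ᵃ is left, and r = D - k is the degree read
  -- off in (1 + x)ᵃ.
  W-binomial : ∀ a {k} r → k + r ≡ D → W D a 1 k ≡ + (a C r)
  W-binomial zero {k} zero eq = cong₂ _+ᶻ_ (χ-at 1 (trans (ℕₚ.+-suc k 0) (cong suc eq)))
    (cong₂ _+ᶻ_ (χ-at {suc k} 0 (cong suc eq)) (W-vanish 0 0 (2 + k) (ℕₚ.m<n⇒m<1+n
      (ℕₚ.≤-reflexive (cong suc (trans (sym eq) (ℕₚ.+-identityʳ k)))))))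
  W-binomial zero {k} (suc r) eq = begin
    W D 0 0 k +ᶻ (W D 0 0 (1 + k) +ᶻ W D 0 0 (2 + k))
      ≡⟨ cong₂ _+ᶻ_ (χ-at (2 + r) (trans (ℕₚ.+-suc k (suc r)) (cong suc eq)))
           (cong₂ _+ᶻ_ (χ-at {suc k} (1 + r) (cong suc eq))
             (χ-at {2 + k} r (cong suc (trans (sym (ℕₚ.+-suc k r)) eq)))) ⟩
    χ (2 + r) +ᶻ (χ (1 + r) +ᶻ χ r)
      ≡⟨ χ-sum r ⟩
    0ℤ ∎
    where open ≡-Reasoning
  W-binomial (suc a) {k} zero eq = cong₂ _+ᶻ_ (W-binomial a zero eq)
    (W-vanish a 1 (suc k) (ℕₚ.≤-reflexive (cong suc (trans (sym eq) (ℕₚ.+-identityʳ k)))))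
  W-binomial (suc a) {k} (suc r) eq = begin
    W D a 1 k +ᶻ W D a 1 (suc k)
      ≡⟨ cong₂ _+ᶻ_ (W-binomial a (suc r) eq)
           (W-binomial a r (trans (sym (ℕₚ.+-suc k r)) eq)) ⟩
    + (a C suc r + a C r)
      ≡⟨ cong +_ (ℕₚ.+-comm (a C suc r) (a C r)) ⟩
    + (a C r + a C suc r)
      ≡⟨ cong +_ (nCk+nC[k+1]≡[n+1]C[k+1] a r) ⟩
    + (suc a C suc r) ∎
    where open ≡-Reasoning

  private
    -- Here k < D < l, so neither of the monomials xᵏ and xˡ has degree D.
    δ-vanish : ∀ {k l} → k + l ≡ 2 * D → k < D → W D 0 1 k ≡ W D 0 1 l
    δ-vanish {k} {l} eq k<D = trans (W-binomial 0 (suc r) k+[1+r]≡D)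
      (sym (W-vanish 0 1 l (ℕₚ.≰⇒> l≰D)))
      where
      r = D ∸ suc k
      k+[1+r]≡D : k + suc r ≡ D
      k+[1+r]≡D = trans (ℕₚ.+-suc k r) (ℕₚ.m+[n∸m]≡n k<D)
      l≰D : ¬ (l ≤ D)
      l≰D l≤D = ℕₚ.<⇒≢ (ℕₚ.+-mono-<-≤ k<D l≤D)
        (trans eq (cong (_+_ D) (ℕₚ.+-identityʳ D)))

  -- (1 + x)ᵃ Nⁱ is palindromic of degree a + 2i, and the hypothesis makes D - k and D - l mirror
  -- degrees. In the induction the terms of a factor 1 + x or N are paired in opposite order.
  W-palindromic : ∀ a i k l → k + l + (a + 2 * i) ≡ 2 * D →
    W D a (suc i) k ≡ W D a (suc i) l
  W-palindromic zero zero k l eq = lemma (ℕₚ.<-cmp k D)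
    where
    k+l≡2D : k + l ≡ 2 * D
    k+l≡2D = trans (sym (ℕₚ.+-identityʳ (k + l))) eq
    lemma : Tri (k < D) (k ≡ D) (D < k) → W D 0 1 k ≡ W D 0 1 l
    lemma (tri< k<D _ _) = δ-vanish k+l≡2D k<D
    lemma (tri≈ _ refl _) = cong (W D 0 1) (sym (trans
      (ℕₚ.+-cancelˡ-≡ D l (1 * D) k+l≡2D) (ℕₚ.+-identityʳ D)))
    lemma (tri> _ _ D<k) = sym (δ-vanish (trans (ℕₚ.+-comm l k) k+l≡2D)
      (ℕₚ.≰⇒> λ D≤l → ℕₚ.<⇒≢ (ℕₚ.+-mono-<-≤ D<k D≤l)
        (sym (trans k+l≡2D (cong (_+_ D) (ℕₚ.+-identityʳ D))))))
  W-palindromic zero (suc i) k l eq = begin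
    W D 0 (suc i) k +ᶻ (W D 0 (suc i) (1 + k) +ᶻ W D 0 (suc i) (2 + k))
      ≡⟨ cong₂ _+ᶻ_ (W-palindromic 0 i k (2 + l) (trans (e₁ i k l) eq))
           (cong₂ _+ᶻ_ (W-palindromic 0 i (1 + k) (1 + l) (trans (e₂ i k l) eq))
                       (W-palindromic 0 i (2 + k) l (trans (e₃ i k l) eq))) ⟩
    W D 0 (suc i) (2 + l) +ᶻ (W D 0 (suc i) (1 + l) +ᶻ W D 0 (suc i) l)
      ≡⟨ reverse (W D 0 (suc i) (2 + l)) (W D 0 (suc i) (1 + l)) (W D 0 (suc i) l) ⟩
    W D 0 (suc i) l +ᶻ (W D 0 (suc i) (1 + l) +ᶻ W D 0 (suc i) (2 + l)) ∎
    where
    open ≡-Reasoning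
    reverse : ∀ x y z → x +ᶻ (y +ᶻ z) ≡ z +ᶻ (y +ᶻ x)
    reverse = ℤ-Solver.solve-∀
    e₁ : ∀ i k l → k + (2 + l) + (0 + 2 * i) ≡ k + l + (0 + 2 * suc i)
    e₁ = ℕ-Solver.solve-∀
    e₂ : ∀ i k l → (1 + k) + (1 + l) + (0 + 2 * i) ≡ k + l + (0 + 2 * suc i)
    e₂ = ℕ-Solver.solve-∀
    e₃ : ∀ i k l → (2 + k) + l + (0 + 2 * i) ≡ k + l + (0 + 2 * suc i)
    e₃ = ℕ-Solver.solve-∀
  W-palindromic (suc a) i k l eq = trans
    (cong₂ _+ᶻ_ (W-palindromic a i k (suc l) (trans (e₁ a i k l) eq))
                (W-palindromic a i (suc k) l (trans (e₂ a i k l) eq)))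
    (ℤₚ.+-comm (W D a (suc i) (suc l)) (W D a (suc i) l))
    where
    e₁ : ∀ a i k l → k + suc l + (a + 2 * i) ≡ k + l + (suc a + 2 * i)
    e₁ = ℕ-Solver.solve-∀
    e₂ : ∀ a i k l → suc k + l + (a + 2 * i) ≡ k + l + (suc a + 2 * i)
    e₂ = ℕ-Solver.solve-∀

  -- (1 + x)² = N + x.
  W-square : ∀ a i k →
    W D (2 + a) i k ≡ W D a (suc i) k +ᶻ W D a i (suc k)
  W-square a i k = trans (rearrange (W D a i k) (W D a i (1 + k)) (W D a i (2 + k)))
    (cong (_+ᶻ W D a i (suc k)) (sym (W-trinomial a i k)))
    where
    rearrange : ∀ x y z →
      (x +ᶻ y) +ᶻ (y +ᶻ z) ≡ (x +ᶻ (y +ᶻ z)) +ᶻ y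
    rearrange = ℤ-Solver.solve-∀

  -- As 1 + x = N - x², multiplying xˡ/N by 1 + x gives xˡ - x²·xˡ/N. The bound forces l < D for
  -- each monomial xˡ split off, so these do not reach degree D.
  W-alternating : ∀ n k → n * 2 + k ≤ suc D →
    W D n 0 k ≡ sgn n *ᶻ W D 0 0 (n * 2 + k)
  W-alternating zero    k _ = sym (ℤₚ.*-identityˡ (W D 0 0 k))
  W-alternating (suc n) k le = begin
    W D n 0 k +ᶻ W D n 0 (suc k)
      ≡⟨ cong₂ _+ᶻ_ (W-alternating n k (ℕₚ.≤-trans (ℕₚ.m≤n+m l 2) le))
           (trans (W-alternating n (suc k)
                    (ℕₚ.≤-trans (ℕₚ.≤-reflexive (ℕₚ.+-suc (n * 2) k))
                      (ℕₚ.≤-trans (ℕₚ.n≤1+n (suc l)) le)))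
                  (cong (λ t → sgn n *ᶻ W D 0 0 t) (ℕₚ.+-suc (n * 2) k))) ⟩
    sgn n *ᶻ ψ₀ +ᶻ sgn n *ᶻ ψ₁
      ≡⟨ rearrange (sgn n) ψ₀ ψ₁ ψ₂ ⟩
    sgn n *ᶻ (ψ₀ +ᶻ (ψ₁ +ᶻ ψ₂)) +ᶻ (-ᶻ sgn n) *ᶻ ψ₂
      ≡⟨ cong (λ t → sgn n *ᶻ t +ᶻ (-ᶻ sgn n) *ᶻ ψ₂) (W-binomial 0 {l} (suc r) l+[1+r]≡D) ⟩
    sgn n *ᶻ 0ℤ +ᶻ (-ᶻ sgn n) *ᶻ ψ₂
      ≡⟨ annihilate (sgn n) ((-ᶻ sgn n) *ᶻ ψ₂) ⟩
    (-ᶻ sgn n) *ᶻ ψ₂ ∎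
    where
    open ≡-Reasoning
    l = n * 2 + k
    ψ₀ = W D 0 0 l
    ψ₁ = W D 0 0 (1 + l)
    ψ₂ = W D 0 0 (2 + l)
    r = D ∸ suc l
    l+[1+r]≡D : l + suc r ≡ D
    l+[1+r]≡D = trans (ℕₚ.+-suc l r) (ℕₚ.m+[n∸m]≡n (ℕₚ.≤-pred le))
    rearrange : ∀ s x y z → s *ᶻ x +ᶻ s *ᶻ y ≡ s *ᶻ (x +ᶻ (y +ᶻ z)) +ᶻ (-ᶻ s) *ᶻ z
    rearrange = ℤ-Solver.solve-∀
    annihilate : ∀ s x → s *ᶻ 0ℤ +ᶻ x ≡ x
    annihilate = ℤ-Solver.solve-∀

  -- Iterates (1 + x)²/N = 1 + x/N. Each step splits off a power (1 + x)²ⁿ, and since k + n is kept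
  -- constant, its coefficient is always taken in the middle degree n.
  central-sum : ∀ n k → k + n ≡ suc D →
    W D (2 * n) 0 k ≡ + sum (applyUpTo (λ l → (2 * l) C l) n)
  central-sum zero    k eq =
    W-vanish 0 0 k (ℕₚ.≤-reflexive (trans (sym eq) (ℕₚ.+-identityʳ k)))
  central-sum (suc n) k eq = begin
    W D (2 * suc n) 0 k
      ≡⟨ cong (λ a → W D a 0 k) (ℕₚ.*-suc 2 n) ⟩
    W D (2 + 2 * n) 0 k
      ≡⟨ W-square (2 * n) 0 k ⟩
    W D (2 * n) 1 k +ᶻ W D (2 * n) 0 (suc k)
      ≡⟨ cong₂ _+ᶻ_ (W-binomial (2 * n) n (ℕₚ.suc-injective 1+k+n≡1+D))
           (central-sum n (suc k) 1+k+n≡1+D) ⟩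
    + (f n + sum (applyUpTo f n))
      ≡⟨ cong +_ (sum-snoc n) ⟩
    + sum (applyUpTo f (suc n)) ∎
    where
    open ≡-Reasoning
    f : ℕ → ℕ
    f l = (2 * l) C l
    1+k+n≡1+D : suc k + n ≡ suc D
    1+k+n≡1+D = trans (sym (ℕₚ.+-suc k n)) eq
    sum-snoc : ∀ n → f n + sum (applyUpTo f n) ≡ sum (applyUpTo f (suc n))
    sum-snoc n = begin
      f n + sum (applyUpTo f n)
        ≡⟨ ℕₚ.+-comm (f n) _ ⟩
      sum (applyUpTo f n) + f n
        ≡⟨ cong (_+_ (sum (applyUpTo f n))) (ℕₚ.+-identityʳ (f n)) ⟨
      sum (applyUpTo f n) + sum [ f n ]
        ≡⟨ sum-++ (applyUpTo f n) [ f n ] ⟨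
      sum (applyUpTo f n ++ [ f n ])
        ≡⟨ cong sum (applyUpTo-∷ʳ f n) ⟩
      sum (applyUpTo f (suc n)) ∎

-- Symmetric functions of 1 + x, -1 and -x

-- The common recursion of the power sums (c₀ = 3, c₂ = 2) and the complete
-- homogeneous functions (c₀ = c₂ = 1) of three quantities with e₁ = 0, e₂ = −N,
-- e₃ = V; the monomial Nⁱ Vʲ is replaced by an arbitrary value G i j.
comb : ℤ → ℤ → ℕ → (ℕ → ℕ → ℤ) → ℕ → ℕ → ℤ
comb c₀ c₂ 0 G i j = c₀ *ᶻ G i j
comb c₀ c₂ 1 G i j = 0ℤ
comb c₀ c₂ 2 G i j = c₂ *ᶻ G (suc i) j
comb c₀ c₂ (suc (suc (suc n))) G i j =
  comb c₀ c₂ (suc n) G (suc i) j +ᶻ comb c₀ c₂ n G i (suc j)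

powerSum complete : ℕ → (ℕ → ℕ → ℤ) → ℕ → ℕ → ℤ
powerSum = comb (+ 3) (+ 2)
complete = comb 1ℤ 1ℤ

private
  weight-i : ∀ n i j → suc n + (2 * suc i + 3 * j) ≡ 3 + n + (2 * i + 3 * j)
  weight-i = ℕ-Solver.solve-∀

  weight-j : ∀ n i j → n + (2 * i + 3 * suc j) ≡ 3 + n + (2 * i + 3 * j)
  weight-j = ℕ-Solver.solve-∀

  weight-2 : ∀ i j → 2 * suc i + 3 * j ≡ 2 + (2 * i + 3 * j)
  weight-2 = ℕ-Solver.solve-∀

  scale : ∀ s t c x y z → s *ᶻ x ≡ y +ᶻ t *ᶻ z →
    s *ᶻ (c *ᶻ x) ≡ c *ᶻ y +ᶻ t *ᶻ (c *ᶻ z)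
  scale s t c x y z eq =
    trans (swap s c x) (trans (cong (c *ᶻ_) eq) (expand t c y z))
    where
    swap : ∀ s c x → s *ᶻ (c *ᶻ x) ≡ c *ᶻ (s *ᶻ x)
    swap = ℤ-Solver.solve-∀
    expand : ∀ t c y z → c *ᶻ (y +ᶻ t *ᶻ z) ≡ c *ᶻ y +ᶻ t *ᶻ (c *ᶻ z)
    expand = ℤ-Solver.solve-∀

module _ (c₀ c₂ : ℤ) where

  -- With N of weight 2 and V of weight 3, the recursion preserves n + 2i + 3j, so only values of G
  -- at that total weight enter.
  comb-∣ : ∀ {d} G n i j →
    (∀ x y → 2 * x + 3 * y ≡ n + (2 * i + 3 * j) → d ∣ᶻ G x y) →
    d ∣ᶻ comb c₀ c₂ n G i j
  comb-∣ G 0 i j h = ∣n⇒∣m*n c₀ (h i j refl)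
  comb-∣ G 1 i j h = divides 0ℤ refl
  comb-∣ G 2 i j h = ∣n⇒∣m*n c₂ (h (suc i) j (weight-2 i j))
  comb-∣ G (suc (suc (suc n))) i j h = ∣m∣n⇒∣m+n
    (comb-∣ G (suc n) (suc i) j λ x y e → h x y (trans e (weight-i n i j)))
    (comb-∣ G n i (suc j) λ x y e → h x y (trans e (weight-j n i j)))

  -- The relation is asked for only at the weight that occurs, because the Bézout splitting in
  -- `powerSum-∣` is available only there.
  comb-linear : ∀ s t {G G₁ G₂} n i j →
    (∀ x y → 2 * x + 3 * y ≡ n + (2 * i + 3 * j) →
      s *ᶻ G x y ≡ G₁ x y +ᶻ t *ᶻ G₂ x y) →
    s *ᶻ comb c₀ c₂ n G i j ≡ comb c₀ c₂ n G₁ i j +ᶻ t *ᶻ comb c₀ c₂ n G₂ i j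
  comb-linear s t {G} {G₁} {G₂} 0 i j h =
    scale s t c₀ (G i j) (G₁ i j) (G₂ i j) (h i j refl)
  comb-linear s t 1 i j h = lemma s t
    where
    lemma : ∀ s t → s *ᶻ 0ℤ ≡ 0ℤ +ᶻ t *ᶻ 0ℤ
    lemma = ℤ-Solver.solve-∀
  comb-linear s t {G} {G₁} {G₂} 2 i j h =
    scale s t c₂ (G (suc i) j) (G₁ (suc i) j) (G₂ (suc i) j) (h (suc i) j (weight-2 i j))
  comb-linear s t {G} {G₁} {G₂} (suc (suc (suc n))) i j h = begin
    s *ᶻ (comb c₀ c₂ (suc n) G (suc i) j +ᶻ comb c₀ c₂ n G i (suc j))
      ≡⟨ ℤₚ.*-distribˡ-+ s (comb c₀ c₂ (suc n) G (suc i) j) (comb c₀ c₂ n G i (suc j)) ⟩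
    s *ᶻ comb c₀ c₂ (suc n) G (suc i) j +ᶻ s *ᶻ comb c₀ c₂ n G i (suc j)
      ≡⟨ cong₂ _+ᶻ_
           (comb-linear s t (suc n) (suc i) j λ x y e → h x y (trans e (weight-i n i j)))
           (comb-linear s t n i (suc j) λ x y e → h x y (trans e (weight-j n i j))) ⟩
    (comb c₀ c₂ (suc n) G₁ (suc i) j +ᶻ t *ᶻ comb c₀ c₂ (suc n) G₂ (suc i) j) +ᶻ
      (comb c₀ c₂ n G₁ i (suc j) +ᶻ t *ᶻ comb c₀ c₂ n G₂ i (suc j))
      ≡⟨ interchange t (comb c₀ c₂ (suc n) G₁ (suc i) j) (comb c₀ c₂ (suc n) G₂ (suc i) j)
           (comb c₀ c₂ n G₁ i (suc j)) (comb c₀ c₂ n G₂ i (suc j)) ⟩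
    comb c₀ c₂ (3 + n) G₁ i j +ᶻ t *ᶻ comb c₀ c₂ (3 + n) G₂ i j ∎
    where
    open ≡-Reasoning
    interchange : ∀ t x y z w →
      (x +ᶻ t *ᶻ y) +ᶻ (z +ᶻ t *ᶻ w) ≡ (x +ᶻ z) +ᶻ t *ᶻ (y +ᶻ w)
    interchange = ℤ-Solver.solve-∀

-- Compares coefficients in the logarithmic derivative of 1 - N t² - V t³, whose reciprocal
-- generates `complete`. Both sides obey the same recursion, so three initial cases suffice.
newton : ∀ n G i j → powerSum (3 + n) G i j ≡
  + 2 *ᶻ complete (suc n) G (suc i) j +ᶻ + 3 *ᶻ complete n G i (suc j)
newton 0 G i j = lemma (G i (suc j))
  where
  lemma : ∀ x → 0ℤ +ᶻ + 3 *ᶻ x ≡ + 2 *ᶻ 0ℤ +ᶻ + 3 *ᶻ (1ℤ *ᶻ x)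
  lemma = ℤ-Solver.solve-∀
newton 1 G i j = lemma (G (2 + i) j)
  where
  lemma : ∀ x → + 2 *ᶻ x +ᶻ 0ℤ ≡ + 2 *ᶻ (1ℤ *ᶻ x) +ᶻ + 3 *ᶻ 0ℤ
  lemma = ℤ-Solver.solve-∀
newton 2 G i j = lemma (G (suc i) (suc j))
  where
  lemma : ∀ x → (0ℤ +ᶻ + 3 *ᶻ x) +ᶻ + 2 *ᶻ x ≡ + 2 *ᶻ (0ℤ +ᶻ 1ℤ *ᶻ x) +ᶻ + 3 *ᶻ (1ℤ *ᶻ x)
  lemma = ℤ-Solver.solve-∀
newton (suc (suc (suc n))) G i j = trans
  (cong₂ _+ᶻ_ (newton (suc n) G (suc i) j) (newton n G i (suc j)))
  (lemma (complete (2 + n) G (2 + i) j) (complete (1 + n) G (suc i) (suc j))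
    (complete n G i (2 + j)))
  where
  lemma : ∀ x y z → (+ 2 *ᶻ x +ᶻ + 3 *ᶻ y) +ᶻ (+ 2 *ᶻ y +ᶻ + 3 *ᶻ z) ≡
    + 2 *ᶻ (x +ᶻ y) +ᶻ + 3 *ᶻ (y +ᶻ z)
  lemma = ℤ-Solver.solve-∀

-- Euler's weighting replaces a division of the coefficients c(i,j) by i + j.
euler : ∀ n G i j → powerSum n (λ x y → + (x + y) *ᶻ G x y) i j ≡
  + n *ᶻ complete n G i j +ᶻ + (i + j) *ᶻ powerSum n G i j
euler 0 G i j = lemma (+ (i + j)) (G i j)
  where
  lemma : ∀ s x → + 3 *ᶻ (s *ᶻ x) ≡ 0ℤ *ᶻ (1ℤ *ᶻ x) +ᶻ s *ᶻ (+ 3 *ᶻ x)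
  lemma = ℤ-Solver.solve-∀
euler 1 G i j = lemma (+ (i + j))
  where
  lemma : ∀ s → 0ℤ ≡ 1ℤ *ᶻ 0ℤ +ᶻ s *ᶻ 0ℤ
  lemma = ℤ-Solver.solve-∀
euler 2 G i j = lemma (+ (i + j)) (G (suc i) j)
  where
  lemma : ∀ s x → + 2 *ᶻ ((1ℤ +ᶻ s) *ᶻ x) ≡ + 2 *ᶻ (1ℤ *ᶻ x) +ᶻ s *ᶻ (+ 2 *ᶻ x)
  lemma = ℤ-Solver.solve-∀
euler (suc (suc (suc n))) G i j = begin
  powerSum (suc n) (λ x y → + (x + y) *ᶻ G x y) (suc i) j +ᶻ
    powerSum n (λ x y → + (x + y) *ᶻ G x y) i (suc j)
    ≡⟨ cong₂ _+ᶻ_ (euler (suc n) G (suc i) j) (euler n G i (suc j)) ⟩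
  ((1ℤ +ᶻ + n) *ᶻ f₁ +ᶻ (1ℤ +ᶻ + (i + j)) *ᶻ p₁) +ᶻ
    (+ n *ᶻ f₂ +ᶻ + (i + suc j) *ᶻ p₂)
    ≡⟨ cong (λ t → ((1ℤ +ᶻ + n) *ᶻ f₁ +ᶻ (1ℤ +ᶻ + (i + j)) *ᶻ p₁) +ᶻ
         (+ n *ᶻ f₂ +ᶻ + t *ᶻ p₂)) (ℕₚ.+-suc i j) ⟩
  ((1ℤ +ᶻ + n) *ᶻ f₁ +ᶻ (1ℤ +ᶻ + (i + j)) *ᶻ p₁) +ᶻ
    (+ n *ᶻ f₂ +ᶻ (1ℤ +ᶻ + (i + j)) *ᶻ p₂)
    ≡⟨ collect (+ n) (+ (i + j)) f₁ f₂ p₁ p₂ ⟩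
  ((1ℤ +ᶻ + n) *ᶻ f₁ +ᶻ + n *ᶻ f₂ +ᶻ + (i + j) *ᶻ (p₁ +ᶻ p₂)) +ᶻ (p₁ +ᶻ p₂)
    ≡⟨ cong (((1ℤ +ᶻ + n) *ᶻ f₁ +ᶻ + n *ᶻ f₂ +ᶻ + (i + j) *ᶻ (p₁ +ᶻ p₂)) +ᶻ_)
         (newton n G i j) ⟩
  ((1ℤ +ᶻ + n) *ᶻ f₁ +ᶻ + n *ᶻ f₂ +ᶻ + (i + j) *ᶻ (p₁ +ᶻ p₂)) +ᶻ
    (+ 2 *ᶻ f₁ +ᶻ + 3 *ᶻ f₂)
    ≡⟨ finish (+ n) (+ (i + j) *ᶻ (p₁ +ᶻ p₂)) f₁ f₂ ⟩
  (+ 3 +ᶻ + n) *ᶻ (f₁ +ᶻ f₂) +ᶻ + (i + j) *ᶻ (p₁ +ᶻ p₂) ∎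
  where
  open ≡-Reasoning
  f₁ = complete (suc n) G (suc i) j
  f₂ = complete n G i (suc j)
  p₁ = powerSum (suc n) G (suc i) j
  p₂ = powerSum n G i (suc j)
  collect : ∀ n s f₁ f₂ p₁ p₂ →
    ((1ℤ +ᶻ n) *ᶻ f₁ +ᶻ (1ℤ +ᶻ s) *ᶻ p₁) +ᶻ (n *ᶻ f₂ +ᶻ (1ℤ +ᶻ s) *ᶻ p₂) ≡
    ((1ℤ +ᶻ n) *ᶻ f₁ +ᶻ n *ᶻ f₂ +ᶻ s *ᶻ (p₁ +ᶻ p₂)) +ᶻ (p₁ +ᶻ p₂)
  collect = ℤ-Solver.solve-∀
  finish : ∀ n t f₁ f₂ → ((1ℤ +ᶻ n) *ᶻ f₁ +ᶻ n *ᶻ f₂ +ᶻ t) +ᶻ (+ 2 *ᶻ f₁ +ᶻ + 3 *ᶻ f₂) ≡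
    (+ 3 +ᶻ n) *ᶻ (f₁ +ᶻ f₂) +ᶻ t
  finish = ℤ-Solver.solve-∀

-- The right side is the power sum (1 + x)ⁿ + (-1)ⁿ + (-x)ⁿ, and both sides satisfy p(n+3) = N
-- p(n+1) + V p(n). A factor V = x(1 + x) raises two exponents at once, hence `W D (y + a) x y`.
W-powerSum : ∀ D a n i j → powerSum n (λ x y → W D (y + a) x y) i j ≡
  W D (n + (j + a)) i j +ᶻ sgn n *ᶻ (W D (j + a) i j +ᶻ W D (j + a) i (n + j))
W-powerSum D a 0 i j = lemma (W D (j + a) i j)
  where
  lemma : ∀ x → + 3 *ᶻ x ≡ x +ᶻ 1ℤ *ᶻ (x +ᶻ x)
  lemma = ℤ-Solver.solve-∀
W-powerSum D a 1 i j = lemma (W D (j + a) i j) (W D (j + a) i (suc j))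
  where
  lemma : ∀ x y → 0ℤ ≡ (x +ᶻ y) +ᶻ (-ᶻ 1ℤ) *ᶻ (x +ᶻ y)
  lemma = ℤ-Solver.solve-∀
W-powerSum D a 2 i j = trans (cong (+ 2 *ᶻ_) (W-trinomial D (j + a) i j))
  (lemma (W D (j + a) i j) (W D (j + a) i (1 + j)) (W D (j + a) i (2 + j)))
  where
  lemma : ∀ x y z → + 2 *ᶻ (x +ᶻ (y +ᶻ z)) ≡
    ((x +ᶻ y) +ᶻ (y +ᶻ z)) +ᶻ (-ᶻ (-ᶻ 1ℤ)) *ᶻ (x +ᶻ z)
  lemma = ℤ-Solver.solve-∀
W-powerSum D a (suc (suc (suc n))) i j = begin
  powerSum (suc n) G (suc i) j +ᶻ powerSum n G i (suc j)
    ≡⟨ cong₂ _+ᶻ_ (W-powerSum D a (suc n) (suc i) j) (W-powerSum D a n i (suc j)) ⟩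
  (W D (suc (n + A)) (suc i) j +ᶻ (-ᶻ s) *ᶻ (W D A (suc i) j +ᶻ W D A (suc i) (suc n + j))) +ᶻ
    (W D (n + suc A) i (suc j) +ᶻ s *ᶻ (W D (suc A) i (suc j) +ᶻ W D (suc A) i (n + suc j)))
    -- Each N is expanded as 1 + x(1 + x); what remains is linear in values of `W` with the same
    -- `i`.
    ≡⟨ cong₂ _+ᶻ_
         (cong₂ (λ t u → t +ᶻ (-ᶻ s) *ᶻ u) (W-trinomial D (suc (n + A)) i j)
           (cong₂ _+ᶻ_ (W-trinomial D A i j) (W-trinomial D A i (suc n + j))))
         (cong₂ (λ t u → W D t i (suc j) +ᶻ s *ᶻ (W D (suc A) i (suc j) +ᶻ W D (suc A) i u))
           (ℕₚ.+-suc n A) (ℕₚ.+-suc n j)) ⟩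
  ((b₀ +ᶻ (b₁ +ᶻ b₂)) +ᶻ (-ᶻ s) *ᶻ ((x +ᶻ y) +ᶻ (w₀ +ᶻ (w₁ +ᶻ w₂)))) +ᶻ
    (b₁ +ᶻ s *ᶻ (y +ᶻ (w₀ +ᶻ w₁)))
    ≡⟨ lemma s b₀ b₁ b₂ x y w₀ w₁ w₂ ⟩
  ((b₀ +ᶻ b₁) +ᶻ (b₁ +ᶻ b₂)) +ᶻ (-ᶻ (-ᶻ (-ᶻ s))) *ᶻ (x +ᶻ w₂) ∎
  where
  open ≡-Reasoning
  G : ℕ → ℕ → ℤ
  G x y = W D (y + a) x y
  A = j + a
  s = sgn n
  b₀ = W D (suc (n + A)) i j
  b₁ = W D (suc (n + A)) i (suc j)
  b₂ = W D (suc (n + A)) i (2 + j)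
  x = W D A i j
  y = W D (suc A) i (suc j)
  w₀ = W D A i (1 + n + j)
  w₁ = W D A i (2 + n + j)
  w₂ = W D A i (3 + n + j)
  lemma : ∀ s b₀ b₁ b₂ x y w₀ w₁ w₂ →
    ((b₀ +ᶻ (b₁ +ᶻ b₂)) +ᶻ (-ᶻ s) *ᶻ ((x +ᶻ y) +ᶻ (w₀ +ᶻ (w₁ +ᶻ w₂)))) +ᶻ
      (b₁ +ᶻ s *ᶻ (y +ᶻ (w₀ +ᶻ w₁))) ≡
    ((b₀ +ᶻ b₁) +ᶻ (b₁ +ᶻ b₂)) +ᶻ (-ᶻ (-ᶻ (-ᶻ s))) *ᶻ (x +ᶻ w₂)
  lemma = ℤ-Solver.solve-∀

-- Bézout for prime powers and divisibility of power sums by p²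

prime∤⇒coprime : ∀ {p l} → Prime p → ¬ (p ∣ l) → Coprime l p
prime∤⇒coprime pp p∤l (d∣l , d∣p) with prime⇒irreducible pp d∣p
... | inj₁ d≡1  = d≡1
... | inj₂ refl = contradiction d∣l p∤l

-- The gcd of l and p^(b+1) divides p^b. If p does not divide l, a Bézout relation between l and p
-- is multiplied by p^b; otherwise p is cancelled from l and b lowered.
bézout : ∀ {p} → Prime p → ∀ b l → ¬ (p ^ suc b ∣ l) →
  ∃₂ λ y z → + (p ^ b) ≡ + l *ᶻ y +ᶻ + (p ^ suc b) *ᶻ z
bézout {p} pp b l q∤l with p ∣? l
... | no p∤l with coprime-Bézout (prime∤⇒coprime pp p∤l)
...   | Bézout.+- x y eq = + (p ^ b) *ᶻ + x , -ᶻ + y , (begin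
  + (p ^ b)
    ≡⟨ expand (+ (p ^ b)) (+ p) (+ y) ⟩
  + (p ^ b) *ᶻ (1ℤ +ᶻ + y *ᶻ + p) +ᶻ (+ p *ᶻ + (p ^ b)) *ᶻ -ᶻ + y
    ≡⟨ cong₂ (λ t u → + (p ^ b) *ᶻ t +ᶻ u *ᶻ -ᶻ + y) eqᶻ (sym (ℤₚ.pos-* p (p ^ b))) ⟩
  + (p ^ b) *ᶻ (+ x *ᶻ + l) +ᶻ + (p ^ suc b) *ᶻ -ᶻ + y
    ≡⟨ cong (_+ᶻ + (p ^ suc b) *ᶻ -ᶻ + y) (rotate (+ (p ^ b)) (+ x) (+ l)) ⟩
  + l *ᶻ (+ (p ^ b) *ᶻ + x) +ᶻ + (p ^ suc b) *ᶻ -ᶻ + y ∎)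
  where
  open ≡-Reasoning
  eqᶻ : 1ℤ +ᶻ + y *ᶻ + p ≡ + x *ᶻ + l
  eqᶻ = trans (cong (1ℤ +ᶻ_) (sym (ℤₚ.pos-* y p))) (trans (cong +_ eq) (ℤₚ.pos-* x l))
  expand : ∀ P p y → P ≡ P *ᶻ (1ℤ +ᶻ y *ᶻ p) +ᶻ (p *ᶻ P) *ᶻ (-ᶻ y)
  expand = ℤ-Solver.solve-∀
  rotate : ∀ x y z → x *ᶻ (y *ᶻ z) ≡ z *ᶻ (x *ᶻ y)
  rotate = ℤ-Solver.solve-∀
...   | Bézout.-+ x y eq = + (p ^ b) *ᶻ -ᶻ + x , + y , (begin
  + (p ^ b)
    ≡⟨ expand (+ (p ^ b)) (+ x) (+ l) ⟩
  + l *ᶻ (+ (p ^ b) *ᶻ -ᶻ + x) +ᶻ + (p ^ b) *ᶻ (1ℤ +ᶻ + x *ᶻ + l)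
    ≡⟨ cong (λ t → + l *ᶻ (+ (p ^ b) *ᶻ -ᶻ + x) +ᶻ + (p ^ b) *ᶻ t) eqᶻ ⟩
  + l *ᶻ (+ (p ^ b) *ᶻ -ᶻ + x) +ᶻ + (p ^ b) *ᶻ (+ y *ᶻ + p)
    ≡⟨ cong (+ l *ᶻ (+ (p ^ b) *ᶻ -ᶻ + x) +ᶻ_) (rotate (+ (p ^ b)) (+ y) (+ p)) ⟩
  + l *ᶻ (+ (p ^ b) *ᶻ -ᶻ + x) +ᶻ (+ p *ᶻ + (p ^ b)) *ᶻ + y
    ≡⟨ cong (λ t → + l *ᶻ (+ (p ^ b) *ᶻ -ᶻ + x) +ᶻ t *ᶻ + y) (sym (ℤₚ.pos-* p (p ^ b))) ⟩
  + l *ᶻ (+ (p ^ b) *ᶻ -ᶻ + x) +ᶻ + (p ^ suc b) *ᶻ + y ∎)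
  where
  open ≡-Reasoning
  eqᶻ : 1ℤ +ᶻ + x *ᶻ + l ≡ + y *ᶻ + p
  eqᶻ = trans (cong (1ℤ +ᶻ_) (sym (ℤₚ.pos-* x l))) (trans (cong +_ eq) (ℤₚ.pos-* y p))
  expand : ∀ P x l → P ≡ l *ᶻ (P *ᶻ -ᶻ x) +ᶻ P *ᶻ (1ℤ +ᶻ x *ᶻ l)
  expand = ℤ-Solver.solve-∀
  rotate : ∀ x y z → x *ᶻ (y *ᶻ z) ≡ (z *ᶻ x) *ᶻ y
  rotate = ℤ-Solver.solve-∀
bézout {p} pp zero    l q∤l | yes p∣l =
  contradiction (subst (_∣ l) (sym (ℕₚ.*-identityʳ p)) p∣l) q∤l
bézout {p} pp (suc b) l q∤l | yes (ℕ∣.divides l′ refl)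
  with bézout pp b l′ (λ q∣l′ → q∤l
         (subst (p ^ suc (suc b) ∣_) (ℕₚ.*-comm p l′) (ℕ∣.*-monoʳ-∣ p q∣l′)))
... | y , z , eq = y , z , (begin
  + (p * p ^ b)
    ≡⟨ ℤₚ.pos-* p (p ^ b) ⟩
  + p *ᶻ + (p ^ b)
    ≡⟨ cong (+ p *ᶻ_) eq ⟩
  + p *ᶻ (+ l′ *ᶻ y +ᶻ + (p ^ suc b) *ᶻ z)
    ≡⟨ distribute (+ p) (+ l′) (+ (p ^ suc b)) y z ⟩
  (+ l′ *ᶻ + p) *ᶻ y +ᶻ (+ p *ᶻ + (p ^ suc b)) *ᶻ z
    ≡⟨ cong₂ (λ t u → t *ᶻ y +ᶻ u *ᶻ z) (sym (ℤₚ.pos-* l′ p)) (sym (ℤₚ.pos-* p (p ^ suc b))) ⟩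
  + (l′ * p) *ᶻ y +ᶻ + (p ^ suc (suc b)) *ᶻ z ∎)
  where
  open ≡-Reasoning
  distribute : ∀ p l q y z → p *ᶻ (l *ᶻ y +ᶻ q *ᶻ z) ≡ (l *ᶻ p) *ᶻ y +ᶻ (p *ᶻ q) *ᶻ z
  distribute = ℤ-Solver.solve-∀

module _ {p} (pp : Prime p) (b : ℕ) where

  private
    q = p ^ suc b
    instance
      p≢0 : ℕ.NonZero p
      p≢0 = prime⇒nonZero pp
      p^b≢0 : ℕ.NonZero (p ^ b)
      p^b≢0 = ℕₚ.m^n≢0 p b

    -- Turns the Bézout multipliers into functions of l, so that they can be absorbed into G. At
    -- multiples of q the zeros are placeholders, and no equation is promised.
    bézout-total : ∀ l → ∃₂ λ y z → ¬ (q ∣ l) → + (p ^ b) ≡ + l *ᶻ y +ᶻ + q *ᶻ z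
    bézout-total l with q ∣? l
    ... | yes q∣l = 0ℤ , 0ℤ , λ q∤l → contradiction q∣l q∤l
    ... | no  q∤l with bézout pp b l q∤l
    ...   | y , z , eq = y , z , λ _ → eq

  -- Multiplying the Bézout relation by n shows that q = p^b · p divides p^b · n.
  q∤l⇒q∣ln⇒p∣n : ∀ l n → ¬ (q ∣ l) → q ∣ l * n → + p ∣ᶻ + n
  q∤l⇒q∣ln⇒p∣n l n q∤l (ℕ∣.divides r eq) with bézout pp b l q∤l
  ... | y , z , bez = *-cancelˡ-∣ (+ (p ^ b)) (divides (y *ᶻ + r +ᶻ z *ᶻ + n) (begin
    + (p ^ b) *ᶻ + n
      ≡⟨ cong (_*ᶻ + n) bez ⟩
    (+ l *ᶻ y +ᶻ + q *ᶻ z) *ᶻ + n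
      ≡⟨ expand (+ l) y (+ q) z (+ n) ⟩
    (+ l *ᶻ + n) *ᶻ y +ᶻ + q *ᶻ z *ᶻ + n
      ≡⟨ cong (λ t → t *ᶻ y +ᶻ + q *ᶻ z *ᶻ + n)
           (trans (sym (ℤₚ.pos-* l n)) (trans (cong +_ eq) (ℤₚ.pos-* r q))) ⟩
    (+ r *ᶻ + q) *ᶻ y +ᶻ + q *ᶻ z *ᶻ + n
      ≡⟨ factor (+ r) (+ q) y z (+ n) ⟩
    (y *ᶻ + r +ᶻ z *ᶻ + n) *ᶻ + q
      ≡⟨ cong ((y *ᶻ + r +ᶻ z *ᶻ + n) *ᶻ_)
           (trans (cong +_ (ℕₚ.*-comm p (p ^ b))) (ℤₚ.pos-* (p ^ b) p)) ⟩
    (y *ᶻ + r +ᶻ z *ᶻ + n) *ᶻ (+ (p ^ b) *ᶻ + p) ∎))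
    where
    open ≡-Reasoning
    expand : ∀ l y q z n → (l *ᶻ y +ᶻ q *ᶻ z) *ᶻ n ≡ (l *ᶻ n) *ᶻ y +ᶻ q *ᶻ z *ᶻ n
    expand = ℤ-Solver.solve-∀
    factor : ∀ r q y z n → (r *ᶻ q) *ᶻ y +ᶻ q *ᶻ z *ᶻ n ≡ (y *ᶻ r +ᶻ z *ᶻ n) *ᶻ q
    factor = ℤ-Solver.solve-∀

  -- The coefficients (q/(x+y)) C(x+y, x) supply one factor p and G another. To avoid the division,
  -- everything is scaled by p^b: writing p^b G = (x+y) Gy + q Gz and applying `euler` to Gy
  -- extracts a factor q, the cofactor is still divisible by p, and q p = p^b p².
  powerSum-∣ : ∀ G → (∀ x y → 2 * x + 3 * y ≡ q → + p ∣ᶻ G x y) →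
    + (p ^ 2) ∣ᶻ powerSum q G 0 0
  powerSum-∣ G p∣G = *-cancelˡ-∣ (+ (p ^ b))
    (subst (+ (p ^ b) *ᶻ + (p ^ 2) ∣ᶻ_) (sym scaled) p^b*p²∣)
    where
    open ≡-Reasoning
    Gy Gz : ℕ → ℕ → ℤ
    Gy x y = proj₁ (bézout-total (x + y)) *ᶻ G x y
    Gz x y = proj₁ (proj₂ (bézout-total (x + y))) *ᶻ G x y

    -- From 2x + 3y = q > 0 follows 0 < x + y < q. The form `q + 0` is the total weight at i = j =
    -- 0.
    q∤weight : ∀ x y → 2 * x + 3 * y ≡ q + 0 → ¬ (q ∣ x + y)
    q∤weight zero    zero    eq = contradiction
      (ℕₚ.m^n≡0⇒m≡0 p (suc b) (sym (trans eq (ℕₚ.+-identityʳ q)))) (ℕ.≢-nonZero⁻¹ p)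
    q∤weight zero    (suc y) eq q∣ = ℕₚ.<⇒≱ (ℕₚ.≤-trans
      (ℕₚ.m≤m+n (2 + y) (1 + 2 * y))
      (ℕₚ.≤-reflexive (trans (lemma y) (trans eq (ℕₚ.+-identityʳ q))))) (∣⇒≤ q∣)
      where
      lemma : ∀ y → 2 + y + (1 + 2 * y) ≡ 2 * 0 + 3 * suc y
      lemma = ℕ-Solver.solve-∀
    q∤weight (suc x) y       eq q∣ = ℕₚ.<⇒≱ (ℕₚ.≤-trans
      (ℕₚ.m≤m+n (2 + (x + y)) (x + 2 * y))
      (ℕₚ.≤-reflexive (trans (lemma x y) (trans eq (ℕₚ.+-identityʳ q))))) (∣⇒≤ q∣)
      where
      lemma : ∀ x y → 2 + (x + y) + (x + 2 * y) ≡ 2 * suc x + 3 * y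
      lemma = ℕ-Solver.solve-∀

    split : ∀ x y → 2 * x + 3 * y ≡ q + 0 →
      + (p ^ b) *ᶻ G x y ≡ + (x + y) *ᶻ Gy x y +ᶻ + q *ᶻ Gz x y
    split x y eq = trans
      (cong (_*ᶻ G x y) (proj₂ (proj₂ (bézout-total (x + y))) (q∤weight x y eq)))
      (expand (+ (x + y)) (proj₁ (bézout-total (x + y))) (+ q)
        (proj₁ (proj₂ (bézout-total (x + y)))) (G x y))
      where
      expand : ∀ l y q z g → (l *ᶻ y +ᶻ q *ᶻ z) *ᶻ g ≡ l *ᶻ (y *ᶻ g) +ᶻ q *ᶻ (z *ᶻ g)
      expand = ℤ-Solver.solve-∀

    scaled : + (p ^ b) *ᶻ powerSum q G 0 0 ≡
      + q *ᶻ (complete q Gy 0 0 +ᶻ powerSum q Gz 0 0)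
    scaled = begin
      + (p ^ b) *ᶻ powerSum q G 0 0
        ≡⟨ comb-linear (+ 3) (+ 2) (+ (p ^ b)) (+ q) q 0 0 split ⟩
      powerSum q (λ x y → + (x + y) *ᶻ Gy x y) 0 0 +ᶻ + q *ᶻ powerSum q Gz 0 0
        -- At i = j = 0 the second term of `euler` carries the factor 0.
        ≡⟨ cong (_+ᶻ + q *ᶻ powerSum q Gz 0 0) (euler q Gy 0 0) ⟩
      (+ q *ᶻ complete q Gy 0 0 +ᶻ 0ℤ) +ᶻ + q *ᶻ powerSum q Gz 0 0
        ≡⟨ factor (+ q) (complete q Gy 0 0) (powerSum q Gz 0 0) ⟩
      + q *ᶻ (complete q Gy 0 0 +ᶻ powerSum q Gz 0 0) ∎
      where
      factor : ∀ q x y → (q *ᶻ x +ᶻ 0ℤ) +ᶻ q *ᶻ y ≡ q *ᶻ (x +ᶻ y)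
      factor = ℤ-Solver.solve-∀

    p∣sum : + p ∣ᶻ complete q Gy 0 0 +ᶻ powerSum q Gz 0 0
    p∣sum = ∣m∣n⇒∣m+n
      (comb-∣ 1ℤ 1ℤ Gy q 0 0 λ x y eq →
        ∣n⇒∣m*n (proj₁ (bézout-total (x + y))) (p∣G x y (trans eq (ℕₚ.+-identityʳ q))))
      (comb-∣ (+ 3) (+ 2) Gz q 0 0 λ x y eq →
        ∣n⇒∣m*n (proj₁ (proj₂ (bézout-total (x + y)))) (p∣G x y (trans eq (ℕₚ.+-identityʳ q))))

    p^b*p²∣ : + (p ^ b) *ᶻ + (p ^ 2) ∣ᶻ + q *ᶻ (complete q Gy 0 0 +ᶻ powerSum q Gz 0 0)
    p^b*p²∣ = subst (_∣ᶻ + q *ᶻ (complete q Gy 0 0 +ᶻ powerSum q Gz 0 0))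
      q*p≡p^b*p² (*-monoʳ-∣ (+ q) p∣sum)
      where
      q*p≡p^b*p² : + q *ᶻ + p ≡ + (p ^ b) *ᶻ + (p ^ 2)
      q*p≡p^b*p² = trans (sym (ℤₚ.pos-* q p)) (trans (cong +_ (lemma p (p ^ b)))
        (ℤₚ.pos-* (p ^ b) (p ^ 2)))
        where
        lemma : ∀ p P → p * P * p ≡ P * (p * (p * 1))
        lemma = ℕ-Solver.solve-∀

-- Binomial identities for the derivative of a power of V

absorption : ∀ n k → suc k * (suc n C suc k) ≡ suc n * (n C k)
absorption zero    zero    = refl
absorption zero    (suc k) = ℕₚ.*-zeroʳ k
absorption (suc n) zero    = begin
  1 * (suc (suc n) C 1)
    ≡⟨ cong (1 *_) (nCk+nC[k+1]≡[n+1]C[k+1] (suc n) 0) ⟨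
  1 * (1 + (suc n C 1))
    ≡⟨ ℕₚ.*-distribˡ-+ 1 1 (suc n C 1) ⟩
  1 + 1 * (suc n C 1)
    ≡⟨ cong suc (absorption n 0) ⟩
  suc (suc n) * 1 ∎
  where open ≡-Reasoning
absorption (suc n) (suc k) = begin
  suc (suc k) * (suc (suc n) C suc (suc k))
    ≡⟨ cong (suc (suc k) *_) (nCk+nC[k+1]≡[n+1]C[k+1] (suc n) (suc k)) ⟨
  suc (suc k) * (A + B)
    ≡⟨ expand k A B ⟩
  A + (suc k * A + suc (suc k) * B)
    ≡⟨ cong (_+_ A) (cong₂ _+_ (absorption n k) (absorption n (suc k))) ⟩
  A + (suc n * (n C k) + suc n * (n C suc k))
    ≡⟨ cong (_+_ A) (ℕₚ.*-distribˡ-+ (suc n) (n C k) (n C suc k)) ⟨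
  A + suc n * (n C k + n C suc k)
    ≡⟨ cong (λ t → A + suc n * t) (nCk+nC[k+1]≡[n+1]C[k+1] n k) ⟩
  suc (suc n) * A ∎
  where
  open ≡-Reasoning
  A = suc n C suc k
  B = suc n C suc (suc k)
  expand : ∀ k A B → suc (suc k) * (A + B) ≡ A + (suc k * A + suc (suc k) * B)
  expand = ℕ-Solver.solve-∀

-- Compares the coefficients of x^(l+e+1) in (l + 1)(1 + 2x) Vˡ = (Vˡ⁺¹)′.
derivative-coefficient : ∀ l e →
  suc l * (l C suc e + 2 * (l C e)) ≡ (2 + l + e) * (suc l C suc e)
derivative-coefficient l e = begin
  suc l * (l C suc e + 2 * (l C e))
    ≡⟨ expand l (l C suc e) (l C e) ⟩
  suc l * (l C e + l C suc e) + suc l * (l C e)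
    ≡⟨ cong₂ (λ t u → suc l * t + u) (nCk+nC[k+1]≡[n+1]C[k+1] l e) (sym (absorption l e)) ⟩
  suc l * (suc l C suc e) + suc e * (suc l C suc e)
    ≡⟨ collect l e (suc l C suc e) ⟩
  (2 + l + e) * (suc l C suc e) ∎
  where
  open ≡-Reasoning
  expand : ∀ l x y → suc l * (x + 2 * y) ≡ suc l * (y + x) + suc l * y
  expand = ℕ-Solver.solve-∀
  collect : ∀ l e x → suc l * x + suc e * x ≡ (2 + l + e) * x
  collect = ℕ-Solver.solve-∀

-- Divisibility by p at weight q, and the congruence for q = 3m + 1

module _ {p} (pp : Prime p) (p%3≡1 : p % 3 ≡ 1)
  (b m : ℕ) (q≡1+3m : p ^ suc b ≡ suc (m * 3)) where

  private
    q = p ^ suc b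
    D = m * 2

  -- Multiplied by xᵐ, this is the coefficient of x^(q-1) in (1 + 2x) V^(k+m) Nⁱ, and N = 1 + V
  -- reduces it to i = 0. There, with l = k + m, l + 1 times the coefficient is a multiple of q,
  -- while 0 < l + 1 < q.
  W-derivative-∣ : ∀ i k → i + k < D →
    + p ∣ᶻ W D (k + m) (suc i) k +ᶻ + 2 *ᶻ W D (k + m) (suc i) (suc k)
  W-derivative-∣ zero k k<D = subst (+ p ∣ᶻ_) (sym coefficients)
    (q∤l⇒q∣ln⇒p∣n pp b (suc l) (l C suc e + 2 * (l C e)) q∤1+l
      (ℕ∣.divides (suc l C suc e) (begin
        suc l * (l C suc e + 2 * (l C e))
          ≡⟨ derivative-coefficient l e ⟩
        (2 + l + e) * (suc l C suc e)
          ≡⟨ cong (_* (suc l C suc e)) 2+l+e≡q ⟩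
        q * (suc l C suc e)
          ≡⟨ ℕₚ.*-comm q (suc l C suc e) ⟩
        (suc l C suc e) * q ∎)))
    where
    open ≡-Reasoning
    l = k + m
    e = D ∸ suc k
    1+k+e≡D : suc k + e ≡ D
    1+k+e≡D = ℕₚ.m+[n∸m]≡n k<D
    coefficients : W D l 1 k +ᶻ + 2 *ᶻ W D l 1 (suc k) ≡ + (l C suc e + 2 * (l C e))
    coefficients = cong₂ _+ᶻ_
      (W-binomial D l (suc e) (trans (ℕₚ.+-suc k e) 1+k+e≡D))
      (trans (cong (+ 2 *ᶻ_) (W-binomial D l e 1+k+e≡D)) (sym (ℤₚ.pos-* 2 (l C e))))
    2+l+e≡q : 2 + l + e ≡ q
    2+l+e≡q = trans (rearrange k m e) (trans (cong (λ t → suc (t + m)) 1+k+e≡D)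
      (trans (cong suc (triple m)) (sym q≡1+3m)))
      where
      rearrange : ∀ k m e → 2 + (k + m) + e ≡ suc (suc k + e + m)
      rearrange = ℕ-Solver.solve-∀
      triple : ∀ m → m * 2 + m ≡ m * 3
      triple = ℕ-Solver.solve-∀
    q∤1+l : ¬ (q ∣ suc l)
    q∤1+l q∣ = ℕₚ.<⇒≱ (ℕₚ.≤-trans (ℕₚ.m≤m+n (2 + l) e) (ℕₚ.≤-reflexive 2+l+e≡q)) (∣⇒≤ q∣)
  W-derivative-∣ (suc i) k i+k<D = subst (+ p ∣ᶻ_)
    (sym (trans
      (cong₂ (λ t u → t +ᶻ + 2 *ᶻ u) (W-trinomial D (k + m) (suc i) k)
        (W-trinomial D (k + m) (suc i) (suc k)))
      (rearrange (W D (k + m) (suc i) k) (W D (suc k + m) (suc i) (suc k))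
        (W D (k + m) (suc i) (suc k)) (W D (suc k + m) (suc i) (2 + k)))))
    (∣m∣n⇒∣m+n (W-derivative-∣ i k (ℕₚ.<-trans (ℕₚ.n<1+n (i + k)) i+k<D))
      (W-derivative-∣ i (suc k) (subst (_< D) (sym (ℕₚ.+-suc i k)) i+k<D)))
    where
    rearrange : ∀ x y z w → (x +ᶻ y) +ᶻ + 2 *ᶻ (z +ᶻ w) ≡
      (x +ᶻ + 2 *ᶻ z) +ᶻ (y +ᶻ + 2 *ᶻ w)
    rearrange = ℤ-Solver.solve-∀

  W-weight-∣ : ∀ x y → 2 * x + 3 * y ≡ q → + p ∣ᶻ W D (y + suc m) x y
  -- Without a factor N the weight q would be a multiple of 3.
  W-weight-∣ zero    y eq = contradiction
    (trans (sym (m*n%n≡0 y 3)) (trans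
      (cong (_% 3) (trans (ℕₚ.*-comm y 3) (trans eq q≡1+3m)))
      ([m+kn]%n≡m%n 1 m 3))) λ ()
  W-weight-∣ (suc x) y eq = subst (λ a → + p ∣ᶻ W D a (suc x) y) (sym (ℕₚ.+-suc y m))
    (subst (+ p ∣ᶻ_) (sym p-multiple)
      (∣m∣n⇒∣m+n (∣m⇒∣m*n (U₀ +ᶻ U₁) (divides 1ℤ (sym (ℤₚ.*-identityˡ (+ p)))))
        (∣n⇒∣m*n (-ᶻ (+ 2 *ᶻ + t)) (W-derivative-∣ x y x+y<D))))
    where
    open ≡-Reasoning
    t = p / 3
    U₀ = W D (y + m) (suc x) y
    U₁ = W D (y + m) (suc x) (suc y)
    weight : suc (2 * x + 3 * y) ≡ m * 3
    weight = ℕₚ.suc-injective (trans (lemma x y) (trans eq q≡1+3m))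
      where
      lemma : ∀ x y → 2 + (2 * x + 3 * y) ≡ 2 * suc x + 3 * y
      lemma = ℕ-Solver.solve-∀
    quadruple : ∀ m → m * 3 + m ≡ 2 * (m * 2)
    quadruple = ℕ-Solver.solve-∀
    U₀≡U₁ : U₀ ≡ U₁
    U₀≡U₁ = W-palindromic D (y + m) x y (suc y)
      (trans (lemma x y m) (trans (cong (_+ m) weight) (quadruple m)))
      where
      lemma : ∀ x y m → y + suc y + (y + m + 2 * x) ≡ suc (2 * x + 3 * y) + m
      lemma = ℕ-Solver.solve-∀
    x+y<D : x + y < D
    x+y<D = ℕₚ.*-cancelˡ-< 2 (x + y) D (ℕₚ.≤-trans
      (ℕₚ.≤-trans (ℕₚ.m≤m+n (suc (2 * (x + y))) y)
        (ℕₚ.≤-reflexive (trans (lemma x y) weight)))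
      (ℕₚ.≤-trans (ℕₚ.m≤m+n (m * 3) m) (ℕₚ.≤-reflexive (quadruple m))))
      where
      lemma : ∀ x y → suc (2 * (x + y)) + y ≡ suc (2 * x + 3 * y)
      lemma = ℕ-Solver.solve-∀
    p≡1+3t : + p ≡ 1ℤ +ᶻ + t *ᶻ + 3
    p≡1+3t = trans (cong +_ (trans (m≡m%n+[m/n]*n p 3) (cong (_+ t * 3) p%3≡1)))
      (cong (1ℤ +ᶻ_) (ℤₚ.pos-* t 3))
    -- As p = 1 + 3t, the inverse of 3 modulo p is -t. Hence the multiplier -2t takes U₀ + 2U₁ = 3U₀
    -- to 2U₀ = U₀ + U₁ modulo p.
    p-multiple : U₀ +ᶻ U₁ ≡
      + p *ᶻ (U₀ +ᶻ U₁) +ᶻ (-ᶻ (+ 2 *ᶻ + t)) *ᶻ (U₀ +ᶻ + 2 *ᶻ U₁)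
    p-multiple = begin
      U₀ +ᶻ U₁
        ≡⟨ cong (U₀ +ᶻ_) (sym U₀≡U₁) ⟩
      U₀ +ᶻ U₀
        ≡⟨ lemma (+ t) U₀ ⟩
      (1ℤ +ᶻ + t *ᶻ + 3) *ᶻ (U₀ +ᶻ U₀) +ᶻ (-ᶻ (+ 2 *ᶻ + t)) *ᶻ (U₀ +ᶻ + 2 *ᶻ U₀)
        ≡⟨ cong₂ (λ r u → r *ᶻ (U₀ +ᶻ u) +ᶻ (-ᶻ (+ 2 *ᶻ + t)) *ᶻ (U₀ +ᶻ + 2 *ᶻ u))
             (sym p≡1+3t) U₀≡U₁ ⟩
      + p *ᶻ (U₀ +ᶻ U₁) +ᶻ (-ᶻ (+ 2 *ᶻ + t)) *ᶻ (U₀ +ᶻ + 2 *ᶻ U₁) ∎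
      where
      lemma : ∀ t u → u +ᶻ u ≡
        (1ℤ +ᶻ t *ᶻ + 3) *ᶻ (u +ᶻ u) +ᶻ (-ᶻ (+ 2 *ᶻ t)) *ᶻ (u +ᶻ + 2 *ᶻ u)
      lemma = ℤ-Solver.solve-∀

  central-binomial-sum-∣ : sgn m ≡ 1ℤ → sgn q ≡ ℤ.-1ℤ →
    p ^ 2 ∣ ∑[ k from1to D ] ((2 * k) C k)
  central-binomial-sum-∣ m-even q-odd = ∣⇒∣ᵤ (subst (+ (p ^ 2) ∣ᶻ_) total
    (powerSum-∣ pp b (λ x y → W D (y + suc m) x y) W-weight-∣))
    where
    open ≡-Reasoning
    S = ∑[ k from1to D ] ((2 * k) C k)
    f : ℕ → ℕ
    f l = (2 * l) C l
    -- Since q + m + 1 = 2(D + 1), `central-sum` covers 0 ≤ k ≤ D; the summand 1 is its term k = 0.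
    full-sum : W D (q + suc m) 0 0 ≡ 1ℤ +ᶻ + S
    full-sum = trans (cong (λ a → W D a 0 0) (trans (cong (_+ suc m) q≡1+3m) (lemma m)))
      (central-sum D (suc D) 0 refl)
      where
      lemma : ∀ m → suc (m * 3) + suc m ≡ 2 * suc (m * 2)
      lemma = ℕ-Solver.solve-∀
    -- After one factor 1 + x is split off, `W-alternating` leaves the values χ 1 = 1 and χ 0 = 0;
    -- the second sits exactly at the limit `suc D` of its bound.
    constant-term : W D (suc m) 0 0 ≡ 1ℤ
    constant-term = cong₂ _+ᶻ_
      (trans (W-alternating D m 0 (ℕₚ.≤-trans (ℕₚ.≤-reflexive (ℕₚ.+-identityʳ D)) (ℕₚ.n≤1+n D)))
        (cong₂ _*ᶻ_ m-even (cong χ (trans (cong (suc D ∸_) (ℕₚ.+-identityʳ D)) (ℕₚ.m+n∸n≡m 1 D)))))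
      (trans (W-alternating D m 1 (ℕₚ.≤-reflexive (ℕₚ.+-comm D 1)))
        (cong₂ _*ᶻ_ m-even (cong χ (trans (cong (suc D ∸_) (ℕₚ.+-comm D 1)) (ℕₚ.n∸n≡0 D)))))
    D<q : D < q + 0
    D<q = ℕₚ.≤-trans (s≤s (ℕₚ.*-monoʳ-≤ m (ℕₚ.n≤1+n 2)))
      (ℕₚ.≤-reflexive (trans (sym q≡1+3m) (sym (ℕₚ.+-identityʳ q))))
    total : powerSum q (λ x y → W D (y + suc m) x y) 0 0 ≡ + S
    total = begin
      powerSum q (λ x y → W D (y + suc m) x y) 0 0
        ≡⟨ W-powerSum D (suc m) q 0 0 ⟩
      W D (q + suc m) 0 0 +ᶻ sgn q *ᶻ (W D (suc m) 0 0 +ᶻ W D (suc m) 0 (q + 0))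
        ≡⟨ cong₂ _+ᶻ_ full-sum (cong₂ _*ᶻ_ q-odd (cong₂ _+ᶻ_ constant-term
             (W-vanish D (suc m) 0 (q + 0) D<q))) ⟩
      (1ℤ +ᶻ + S) +ᶻ ℤ.-1ℤ *ᶻ (1ℤ +ᶻ 0ℤ)
        ≡⟨ cancel (+ S) ⟩
      + S ∎
      where
      cancel : ∀ s → (1ℤ +ᶻ s) +ᶻ ℤ.-1ℤ *ᶻ (1ℤ +ᶻ 0ℤ) ≡ s
      cancel = ℤ-Solver.solve-∀

-- Parity through residues modulo 6, and the theorem

sgn-even : ∀ h → sgn (h * 2) ≡ 1ℤ
sgn-even zero    = refl
sgn-even (suc h) = trans (ℤₚ.neg-involutive _) (sgn-even h)

-- The residues modulo 6 lying over 1 modulo 3 are 1 and 4, and 4 would make p even, hence equal to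
-- 2.
prime-%6≡1 : ∀ {p} → Prime p → p % 3 ≡ 1 → p % 6 ≡ 1
prime-%6≡1 {p} pp p%3≡1 = residue (p % 6) refl (m%n<n p 6)
  (trans (m∣n⇒o%n%m≡o%m 3 6 p (ℕ∣.divides 2 refl)) p%3≡1)
  where
  2∤p : ¬ (2 ∣ p)
  2∤p 2∣p with prime⇒irreducible pp 2∣p
  ... | inj₁ ()
  ... | inj₂ refl = contradiction p%3≡1 λ ()
  residue : ∀ r → p % 6 ≡ r → r < 6 → r % 3 ≡ 1 → p % 6 ≡ 1
  residue 0 _ _ ()
  residue 1 eq _ _ = eq
  residue 2 _ _ ()
  residue 3 _ _ ()
  residue 4 eq _ _ = contradiction (ℕ∣.divides (2 + p / 6 * 3)
    (trans (m≡m%n+[m/n]*n p 6) (trans (cong (_+ p / 6 * 6) eq) (lemma (p / 6))))) 2∤p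
    where
    lemma : ∀ k → 4 + k * 6 ≡ (2 + k * 3) * 2
    lemma = ℕ-Solver.solve-∀
  residue 5 _ _ ()
  residue (suc (suc (suc (suc (suc (suc _)))))) _
    (s≤s (s≤s (s≤s (s≤s (s≤s (s≤s ())))))) _

^-%6≡1 : ∀ p a → p % 6 ≡ 1 → (p ^ a) % 6 ≡ 1
^-%6≡1 p zero    eq = refl
^-%6≡1 p (suc a) eq = trans (%-distribˡ-* p (p ^ a) 6)
  (cong₂ (λ x y → (x * y) % 6) eq (^-%6≡1 p a eq))

theorem1p2 : (p a : ℕ) → Prime p → p % 3 ≡ 1 → 1 ≤ a →
    p ^ 2 ∣ ∑[ k from1to upperBound p a ] ((2 * k) C k)
theorem1p2 p (suc b) pp p%3≡1 _ = subst
  (λ n → p ^ 2 ∣ ∑[ k from1to n ] ((2 * k) C k)) (sym bound)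
  (central-binomial-sum-∣ pp p%3≡1 b m q≡1+3m (sgn-even h)
    (trans (cong sgn q≡1+3m) (cong -ᶻ_
      (trans (cong sgn (lemma₂ h)) (sgn-even (h * 3))))))
  where
  q = p ^ suc b
  -- Writing q = 6h + 1 makes m = 2h even and q odd, which settles both signs.
  h = q / 6
  m = h * 2
  lemma₁ : ∀ h → suc (h * 6) ≡ suc (h * 2 * 3)
  lemma₁ = ℕ-Solver.solve-∀
  lemma₂ : ∀ h → h * 2 * 3 ≡ h * 3 * 2
  lemma₂ = ℕ-Solver.solve-∀
  lemma₃ : ∀ m → 2 * (m * 3) ≡ 3 * (m * 2)
  lemma₃ = ℕ-Solver.solve-∀
  q≡1+3m : q ≡ suc (m * 3)
  q≡1+3m = trans (m≡m%n+[m/n]*n q 6) (trans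
    (cong (_+ h * 6) (^-%6≡1 p (suc b) (prime-%6≡1 pp p%3≡1))) (lemma₁ h))
  bound : upperBound p (suc b) ≡ m * 2
  bound = ℕₚ.*-cancelˡ-≡ _ (m * 2) 3 (trans (3*upperBound p (suc b) p%3≡1)
    (trans (cong (λ t → 2 * (t ∸ 1)) q≡1+3m) (lemma₃ m)))
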